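{- Let $n\ge 9$ be an integer and let $G$ be a connected, non-complete graph of order $n$ with $\delta(G)\ge 2$. If $\sigma_4(G)\ge n$, then $cfc(G)=2$.
   Context: All graphs are finite, without loops or multiple edges; the order of $G$ is $|V(G)|$, $d_G(v)$ is the degree of $v$ in $G$, and $\delta(G)$ is the minimum degree of $G$. $\sigma_4(G)$ is the minimum of $\sum_{s\in S} d_G(s)$ over all independent sets $S\subseteq V(G)$ (no two vertices adjacent) with $|S|=4$; by convention $\sigma_4(G)=+\infty$ if $G$ has no independent set of size $4$. Given an edge-colouring of $G$ (not necessarily proper), a path is conflict-free if some colour appears on exactly one of its edges. An edge-coloured graph is conflict-free connected if every pair of distinct vertices is connected by a conflict-free path. The conflict-free connection number $cfc(G)$ of a connected graph $G$ is the minimum number of colours in an edge-colouring making $G$ conflict-free connected. -}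

module Defs where

open import Data.Fin.Base using (Fin)
open import Data.Fin.Properties using (_≟_; all?)
open import Data.Fin.Subset using (Subset; _∈_; ∣_∣; inside; outside)
open import Data.Fin.Subset.Properties using (_∈?_)
open import Data.List.Base using (List; []; _∷_; [_]; _++_; map; filter; length; allFin)
import Data.List.Extrema as Extrema
open import Data.List.Relation.Unary.Unique.Propositional using (Unique)
open import Data.Nat.Base using (ℕ; zero; suc; _≤_)
open import Data.Nat.ListAction using (sum)
import Data.Nat.Properties as ℕ
open import Data.Product.Base using (_×_; ∃-syntax; Σ-syntax)
open import Data.Vec.Base using ([]; _∷_)
open import Level using (0ℓ)
open import Relation.Binary.Bundles using (TotalOrder)
open import Relation.Binary.Construct.Closure.ReflexiveTransitive using (Star; ε; _◅_)
import Relation.Binary.Construct.Add.Supremum.NonStrict as Supremum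
open import Relation.Binary.Core using (Rel)
open import Relation.Binary.Definitions using (Symmetric; Irreflexive; Decidable)
open import Relation.Binary.PropositionalEquality using (_≡_; _≢_)
open import Relation.Nullary.Construct.Add.Supremum using (_⁺; ⊤⁺) renaming ([_] to fin)
open import Relation.Nullary.Decidable using (Dec; _×-dec_; _→-dec_; ¬?)
open import Relation.Nullary.Negation using (¬_)

ℕ∞ : Set
ℕ∞ = ℕ ⁺

open Supremum {A = ℕ} _≤_ public using () renaming (_≤⁺_ to _≤∞_)

≤∞-totalOrder : TotalOrder 0ℓ 0ℓ 0ℓ
≤∞-totalOrder = record
  { isTotalOrder = Supremum.≤⁺-isTotalOrder-≡ _≤_ ℕ.≤-isTotalOrder }

-- The empty list has minimum ⊤⁺, which gives the convention σ = +∞ when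
-- there is no independent set of the required size.
minimum : List ℕ → ℕ∞
minimum ks = Extrema.min ≤∞-totalOrder ⊤⁺ (map fin ks)

record Graph (n : ℕ) : Set₁ where
  infix 4 _~_ _~?_
  field
    _~_      : Rel (Fin n) 0ℓ
    _~?_     : Decidable _~_
    ~-sym    : Symmetric _~_
    ~-irrefl : Irreflexive _≡_ _~_

allSubsets : ∀ n → List (Subset n)
allSubsets zero    = [ [] ]
allSubsets (suc n) = map (inside ∷_) (allSubsets n) ++ map (outside ∷_) (allSubsets n)

module _ {n : ℕ} (G : Graph n) where
  open Graph G

  deg : Fin n → ℕ
  deg v = length (filter (v ~?_) (allFin n))

  δ : ℕ∞
  δ = minimum (map deg (allFin n))

  Complete : Set
  Complete = ∀ u v → u ≢ v → u ~ v

  Connected : Set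
  Connected = ∀ u v → Star _~_ u v

  Independent : Subset n → Set
  Independent S = ∀ u v → u ∈ S → v ∈ S → ¬ u ~ v

  independent? : ∀ S → Dec (Independent S)
  independent? S = all? λ u → all? λ v →
    (u ∈? S) →-dec ((v ∈? S) →-dec ¬? (u ~? v))

  degreeSum : Subset n → ℕ
  degreeSum S = sum (map deg (filter (_∈? S) (allFin n)))

  σ : ℕ → ℕ∞
  σ k = minimum (map degreeSum
    (filter (λ S → independent? S ×-dec (∣ S ∣ ℕ.≟ k)) (allSubsets n)))

  vertices : ∀ {u v} → Star _~_ u v → List (Fin n)
  vertices {u} ε       = [ u ]
  vertices {u} (_ ◅ p) = u ∷ vertices p

  IsPath : ∀ {u v} → Star _~_ u v → Set
  IsPath p = Unique (vertices p)

  -- The adjacency proof is irrelevant and the colour is symmetric in the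
  -- endpoints, so each edge {u , v} gets exactly one colour.
  record EdgeColouring (k : ℕ) : Set where
    field
      colour     : ∀ u v → .(u ~ v) → Fin k
      colour-sym : ∀ u v .(e : u ~ v) → colour u v e ≡ colour v u (~-sym e)

  module _ {k : ℕ} (c : EdgeColouring k) where
    open EdgeColouring c

    colours : ∀ {u v} → Star _~_ u v → List (Fin k)
    colours ε                         = []
    colours (_◅_ {i = u} {j = v} e p) = colour u v e ∷ colours p

    -- A path repeats no edge, so occurrences in the list count edges.
    ConflictFree : ∀ {u v} → Star _~_ u v → Set
    ConflictFree p = ∃[ a ] length (filter (a ≟_) (colours p)) ≡ 1

    ConflictFreeConnected : Set
    ConflictFreeConnected =
      ∀ u v → u ≢ v → Σ[ p ∈ Star _~_ u v ] IsPath p × ConflictFree p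

  CfColourable : ℕ → Set
  CfColourable k = Σ[ c ∈ EdgeColouring k ] ConflictFreeConnected c

  Cfc≡ : ℕ → Set
  Cfc≡ k = CfColourable k × (∀ j → CfColourable j → k ≤ j)

{-# OPTIONS --safe #-}

-- Call a vertex set S good if, for some marking of edges, any two vertices of S
-- are joined inside S by a path without marked edges and also by a path with
-- exactly one. Goodness survives adding an ear: an open ear needs no mark, a
-- closed one gets a single mark at its base. Hence a maximal good set meets each
-- remaining component in a single bridge. Counting common neighbours of four
-- independent vertices, σ₄ ≥ n excludes three branches at one good set as well as
-- four successive bridges, so G is a chain of at most four good sets. Marking only
-- the middle bridge of the chain, all paths needed have one marked edge, except
-- those along a single edge.

module Submission where

open import Defs
open import Data.Bool.Base using (Bool; true; false; _∧_; _∨_; if_then_else_)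
open import Data.Bool.Properties using (∧-comm; ∨-comm)
open import Data.Empty using (⊥; ⊥-elim)
open import Data.Fin.Base using (Fin; zero; suc)
open import Data.Fin.Properties using (_≟_; any?)
open import Data.Fin.Subset as Subset
  using (Subset; _∈_; _∉_; _⊆_; _⊂_; _⊃_; _∪_; _─_; ∁; ⁅_⁆; ⊤; ∣_∣; inside; outside)
open import Data.Fin.Subset.Induction using (Acc; acc; ⊂-wellFounded; ⊃-wellFounded)
open import Data.Fin.Subset.Properties
open import Data.List.Base using (List; []; _∷_; _++_; map; filter; length; allFin)
import Data.List.Extrema as Extrema
import Data.List.Membership.Propositional as List
open import Data.List.Membership.Propositional.Properties
  using (∈-∃++; ∈-++⁺ˡ; ∈-++⁺ʳ; ∈-map⁺; ∈-filter⁺; ∈-filter⁻; ∈-allFin)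
open import Data.List.Properties
  using (filter-++; filter-all; filter-none; filter-some; filter-accept; length-tabulate; map-cong)
open import Data.List.Relation.Binary.Permutation.Propositional.Properties
  using (shift; map⁺; ∈-resp-↭)
open import Data.List.Relation.Binary.Subset.Propositional using () renaming (_⊆_ to _⊆ₗ_)
open import Data.List.Relation.Unary.All as All using (All; []; _∷_)
import Data.List.Relation.Unary.All.Properties as All
open import Data.List.Relation.Unary.AllPairs as AllPairs using (AllPairs; []; _∷_)
open import Data.List.Relation.Unary.Any as Any using (here; there)
open import Data.List.Relation.Unary.Unique.Propositional using (Unique)
import Data.List.Relation.Unary.Unique.Propositional.Properties as Unique
open import Data.Nat.Base
  using (ℕ; zero; suc; _≤_; _<_; _+_; z≤n; s≤s; _≤′_; ≤′-refl; ≤′-step)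
open import Data.Nat.ListAction using (sum)
open import Data.Nat.ListAction.Properties using (sum-↭)
open import Data.Nat.Properties as ℕ
  using (≤-refl; ≤-trans; ≤⇒≤′; ≤′⇒≤; n≤1+n; <-cmp; <⇒≤; <⇒≱; +-mono-≤)
open import Data.Nat.Tactic.RingSolver using (solve-∀)
open import Data.Product.Base using (_×_; _,_; proj₁; proj₂; ∃-syntax; Σ-syntax)
open import Data.Sum.Base using (_⊎_; inj₁; inj₂; [_,_]′)
open import Data.Vec.Base using ([]; _∷_; here; there)
open import Function.Base using (id; _∘_)
open import Level using (0ℓ)
open import Relation.Binary.Construct.Add.Supremum.NonStrict _≤_ using ([≤]-injective; ≤⁺-trans)
open import Relation.Binary.Construct.Closure.ReflexiveTransitive using (Star; ε; _◅_; _◅◅_)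
open import Relation.Binary.Definitions using (tri<; tri≈; tri>)
open import Relation.Binary.PropositionalEquality
  using (_≡_; _≢_; refl; sym; trans; cong; cong₂; subst; subst₂; ≢-sym)
open import Relation.Nullary.Construct.Add.Supremum using ([_])
open import Relation.Nullary.Decidable
  using (Dec; yes; no; does; dec-true; dec-false; _×-dec_; ¬?; decidable-stable)
open import Relation.Nullary.Negation using (¬_; contradiction)
open import Relation.Unary using (Pred; Decidable)

-- Why at most four good sets: two consecutive bridges may share a vertex, and if both were
-- unmarked, their outer ends would be joined only by a path of two unmarked edges. So the proof
-- allows at most one unmarked bridge on either side of the marked one, where the only pair left
-- without a marked path is the pair of adjacent bridge ends. Where the degree conditions enter: for
-- four independent vertices, a degree sum of at least `n` forces their six codegrees to add up to
-- at least 4. Bridges keep codegrees small, since `δ ≥ 2` provides beyond each bridge a vertex all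
-- of whose neighbours stay on its side. Each excluded configuration yields four independent
-- vertices whose codegrees add up to at most 3.

record Marking (n : ℕ) : Set where
  field
    at     : Fin n → Fin n → Bool
    at-sym : ∀ u v → at u v ≡ at v u

open Marking public

module _ {n : ℕ} where

  plain : Marking n
  plain = record { at = λ _ _ → false ; at-sym = λ _ _ → refl }

  full : Marking n
  full = record { at = λ _ _ → true ; at-sym = λ _ _ → refl }

  single : Fin n → Fin n → Marking n
  single a b = record
    { at     = λ u v → (does (u ≟ a) ∧ does (v ≟ b)) ∨ (does (u ≟ b) ∧ does (v ≟ a))
    ; at-sym = λ u v → trans (∨-comm (does (u ≟ a) ∧ does (v ≟ b)) _)
                 (cong₂ _∨_ (∧-comm (does (u ≟ b)) _) (∧-comm (does (u ≟ a)) _))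
    }

  single-here : ∀ a b → at (single a b) b a ≡ true
  single-here a b with b ≟ a
  ... | yes refl rewrite dec-true (a ≟ a) refl = refl
  ... | no _     rewrite dec-true (b ≟ b) refl | dec-true (a ≟ a) refl = refl

  single-elsewhere : ∀ {a b u v} → (u ≢ a ⊎ v ≢ b) → (u ≢ b ⊎ v ≢ a) → at (single a b) u v ≡ false
  single-elsewhere {a} {b} {u} {v} p q = cong₂ _∨_ (off p) (off q)
    where
    off : ∀ {x y} → (u ≢ x ⊎ v ≢ y) → does (u ≟ x) ∧ does (v ≟ y) ≡ false
    off {x} {y} (inj₁ u≢x) rewrite dec-false (u ≟ x) u≢x = refl
    off {x} {y} (inj₂ v≢y) rewrite dec-false (v ≟ y) v≢y = ∧-comm (does (u ≟ x)) false

  -- All that is required of a good set concerns pairs inside it, so keeping `f` there preserves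
  -- goodness whatever `g` does elsewhere. Nested uses on disjoint sets preserve several pieces at
  -- once.
  glue : Subset n → Marking n → Marking n → Marking n
  glue S f g = record
    { at     = λ u v → if does (u ∈? S) ∧ does (v ∈? S) then at f u v else at g u v
    ; at-sym = λ u v → trans
        (cong (λ b → if b then at f u v else at g u v) (∧-comm (does (u ∈? S)) _))
        (cong₂ (λ x y → if does (v ∈? S) ∧ does (u ∈? S) then x else y) (at-sym f u v) (at-sym g u v))
    }

  module _ (S : Subset n) (f g : Marking n) where

    glue-inside : ∀ {u v} → u ∈ S → v ∈ S → at (glue S f g) u v ≡ at f u v
    glue-inside {u} {v} u∈S v∈S
      rewrite dec-true (u ∈? S) u∈S | dec-true (v ∈? S) v∈S = refl

    glue-outsideˡ : ∀ {u v} → u ∉ S → at (glue S f g) u v ≡ at g u v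
    glue-outsideˡ {u} u∉S rewrite dec-false (u ∈? S) u∉S = refl

    glue-outsideʳ : ∀ {u v} → v ∉ S → at (glue S f g) u v ≡ at g u v
    glue-outsideʳ {u} {v} v∉S
      rewrite dec-false (v ∈? S) v∉S | ∧-comm (does (u ∈? S)) false = refl

-- Unmarked walks, and paths with exactly one marked edge

module _ {n : ℕ} (G : Graph n) where
  open Graph G

  paint : Marking n → EdgeColouring G 2
  paint f = record
    { colour     = λ u v _ → if at f u v then suc zero else zero
    ; colour-sym = λ u v _ → cong (λ b → if b then suc zero else zero) (at-sym f u v)
    }

  -- Repeated vertices are allowed so that walks can be concatenated without disjointness
  -- conditions; `shorten` removes repetitions where a genuine path is required.
  data Walk (f : Marking n) (A : Pred (Fin n) 0ℓ) : Fin n → Fin n → Set where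
    stop : ∀ {u} → A u → Walk f A u u
    step : ∀ {u w v} → A u → u ~ w → at f u w ≡ false → Walk f A w v → Walk f A u v

  module _ {f : Marking n} {A : Pred (Fin n) 0ℓ} where

    start∈ : ∀ {u v} → Walk f A u v → A u
    start∈ (stop a)       = a
    start∈ (step a _ _ _) = a

    end∈ : ∀ {u v} → Walk f A u v → A v
    end∈ (stop a)       = a
    end∈ (step _ _ _ p) = end∈ p

    infixr 5 _⋆_
    _⋆_ : ∀ {u v w} → Walk f A u v → Walk f A v w → Walk f A u w
    stop _       ⋆ q = q
    step a e z p ⋆ q = step a e z (p ⋆ q)

    snoc : ∀ {u v w} → Walk f A u v → v ~ w → at f v w ≡ false → A w → Walk f A u w
    snoc p e z a = p ⋆ step (end∈ p) e z (stop a)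

    flip : ∀ {u v} → Walk f A u v → Walk f A v u
    flip (stop a)           = stop a
    flip (step {u} {w} a e z p) = snoc (flip p) (~-sym e) (trans (at-sym f w u) z) a

    widen : ∀ {g B} → (∀ {x} → A x → B x) → (∀ {x y} → A x → A y → at f x y ≡ at g x y) →
            ∀ {u v} → Walk f A u v → Walk g B u v
    widen A⊆B f≗g (stop a)       = stop (A⊆B a)
    widen A⊆B f≗g (step a e z p) =
      step (A⊆B a) e (trans (sym (f≗g a (start∈ p))) z) (widen A⊆B f≗g p)

  module _ (f : Marking n) where

    record Simple (A : Pred (Fin n) 0ℓ) (u v : Fin n) : Set where
      constructor simple
      field
        path   : Star _~_ u v
        isPath : IsPath G path
        stays  : All A (vertices G path)
        pale   : All (zero ≡_) (colours G (paint f) path)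

    suffix : ∀ {A u v w} (p : Star _~_ u v) → w List.∈ vertices G p → IsPath G p →
             All A (vertices G p) → All (zero ≡_) (colours G (paint f) p) → Simple A w v
    suffix ε       (here refl) uq A p = simple ε uq A p
    suffix (e ◅ q) (here refl) uq A p = simple (e ◅ q) uq A p
    suffix (e ◅ q) (there w∈q) (_ ∷ uq) (_ ∷ A) (_ ∷ p) = suffix q w∈q uq A p

    shorten : ∀ {A u v} → Walk f A u v → Simple A u v
    shorten (stop a) = simple ε ([] ∷ []) (a ∷ []) []
    shorten (step {u} {w} a e z p) with shorten p
    ... | simple q uq A pl with Any.any? (u ≟_) (vertices G q)
    ... | yes u∈q = suffix q u∈q uq A pl
    ... | no  u∉q = simple (e ◅ q) (All.¬Any⇒All¬ _ u∉q ∷ uq) (a ∷ A)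
                      (cong (λ b → if b then suc zero else zero) (sym z) ∷ pl)

  vertices-◅◅ : ∀ {u v w x} (p : Star _~_ u v) (e : v ~ w) (q : Star _~_ w x) →
                vertices G (p ◅◅ (e ◅ q)) ≡ vertices G p ++ vertices G q
  vertices-◅◅ ε        e q = refl
  vertices-◅◅ (d ◅ p) e q = cong (_ ∷_) (vertices-◅◅ p e q)

  colours-◅◅ : ∀ {k} (c : EdgeColouring G k) {u v w} (p : Star _~_ u v) (q : Star _~_ v w) →
               colours G c (p ◅◅ q) ≡ colours G c p ++ colours G c q
  colours-◅◅ c ε       q = refl
  colours-◅◅ c (d ◅ p) q = cong (_ ∷_) (colours-◅◅ c p q)

  -- Disjointness of A and B lets the two walks be shortened independently, to a
  -- path whose only marked edge is a b.
  record Split (f : Marking n) (S : Pred (Fin n) 0ℓ) (u v : Fin n) : Set₁ where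
    field
      A B      : Pred (Fin n) 0ℓ
      A⊆S      : ∀ {x} → A x → S x
      B⊆S      : ∀ {x} → B x → S x
      disjoint : ∀ {x} → A x → B x → ⊥
      a b      : Fin n
      edge     : a ~ b
      marked   : at f a b ≡ true
      left     : Walk f A u a
      right    : Walk f B b v

  ConflictFreePath : Marking n → Fin n → Fin n → Set
  ConflictFreePath f u v = Σ[ p ∈ Star _~_ u v ] IsPath G p × ConflictFree G (paint f) p

  module _ {f : Marking n} where

    split⇒path : ∀ {S u v} → Split f S u v → ConflictFreePath f u v
    split⇒path s = path p ◅◅ (edge ◅ path q) ,
      subst Unique (sym (vertices-◅◅ (path p) edge (path q)))
        (Unique.++⁺ (isPath p) (isPath q)
          λ (x∈p , x∈q) → disjoint (All.lookup (Simple.stays p) x∈p) (All.lookup (Simple.stays q) x∈q)) ,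
      suc zero , count
      where
      open Split s
      open Simple
      p = shorten f left
      q = shorten f right
      none : ∀ {xs : List (Fin 2)} → All (zero ≡_) xs → filter (suc zero ≟_) xs ≡ []
      none all = filter-none (suc zero ≟_) (All.map (λ { refl () }) all)
      count : length (filter (suc zero ≟_) (colours G (paint f) (path p ◅◅ (edge ◅ path q)))) ≡ 1
      count rewrite colours-◅◅ (paint f) (path p) (edge ◅ path q)
                  | filter-++ (suc zero ≟_) (colours G (paint f) (path p)) (colours G (paint f) (edge ◅ path q))
                  | none (Simple.pale p) | marked | none (Simple.pale q) = refl

    -- The colour of a single edge occurs once, marked or not. This serves the ends of an unmarked
    -- bridge, which have no split.
    edge⇒path : ∀ {u v} → u ~ v → ConflictFreePath f u v
    edge⇒path {u} {v} e = e ◅ ε , (((λ { refl → ~-irrefl refl e }) ∷ []) ∷ [] ∷ []) , c ,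
      cong length (filter-accept (c ≟_) {c} {[]} refl)
      where c = EdgeColouring.colour (paint f) u v e

    split-flip : ∀ {S u v} → Split f S u v → Split f S v u
    split-flip s = record
      { A = B ; B = A ; A⊆S = B⊆S ; B⊆S = A⊆S ; disjoint = λ x y → disjoint y x
      ; a = b ; b = a ; edge = ~-sym edge ; marked = trans (at-sym f b a) marked
      ; left = flip right ; right = flip left }
      where open Split s

    split-widen : ∀ {g S T u v} → (∀ {x} → S x → T x) → (∀ {x y} → S x → S y → at f x y ≡ at g x y) →
                  Split f S u v → Split g T u v
    split-widen {g} S⊆T f≗g s = record
      { A = A ; B = B ; A⊆S = S⊆T ∘ A⊆S ; B⊆S = S⊆T ∘ B⊆S ; disjoint = disjoint
      ; a = a ; b = b ; edge = edge
      ; marked = trans (sym (f≗g (A⊆S (end∈ left)) (B⊆S (start∈ right)))) marked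
      ; left  = widen id (λ x y → f≗g (A⊆S x) (A⊆S y)) left
      ; right = widen id (λ x y → f≗g (B⊆S x) (B⊆S y)) right }
      where open Split s

    -- Since `X` misses `S`, it can be added to the part before the marked edge without meeting the
    -- part after it, which lies in `S`.
    prolong : ∀ {S T X : Pred (Fin n) 0ℓ} {u v w w′} → (∀ {x} → S x → T x) → (∀ {x} → X x → T x) →
              (∀ {x} → X x → ¬ S x) → Walk f X w w′ → w′ ~ u → at f w′ u ≡ false →
              Split f S u v → Split f T w v
    prolong {X = X} S⊆T X⊆T X∩S p e z s = record
      { A = λ x → X x ⊎ A x ; B = B
      ; A⊆S = [ X⊆T , S⊆T ∘ A⊆S ]′ ; B⊆S = S⊆T ∘ B⊆S
      ; disjoint = [ (λ x y → X∩S x (B⊆S y)) , disjoint ]′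
      ; a = a ; b = b ; edge = edge ; marked = marked
      ; left = widen inj₁ (λ _ _ → refl) p
               ⋆ step (inj₁ (end∈ p)) e z (widen inj₂ (λ _ _ → refl) left)
      ; right = right }
      where open Split s

  -- Good sets and their extension by ears

  record Good (f : Marking n) (S : Subset n) : Set₁ where
    field
      joined : ∀ {u v} → u ∈ S → v ∈ S → Walk f (_∈ S) u v
      split  : ∀ {u v} → u ≢ v → u ∈ S → v ∈ S → Split f (_∈ S) u v

  open Good

  -- The seed from which good sets grow: splits are asked for distinct vertices only, so here there
  -- are none to provide.
  good-⁅⁆ : ∀ r → Good plain ⁅ r ⁆
  good-⁅⁆ r = record
    { joined = λ u∈ v∈ → subst₂ (Walk plain (_∈ ⁅ r ⁆)) (sym (x∈⁅y⁆⇒x≡y r u∈)) (sym (x∈⁅y⁆⇒x≡y r v∈))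
                 (stop (x∈⁅x⁆ r))
    ; split  = λ u≢v u∈ v∈ → contradiction (trans (x∈⁅y⁆⇒x≡y r u∈) (sym (x∈⁅y⁆⇒x≡y r v∈))) u≢v }

  -- Only the inner vertices `p 0`, ..., `p m` are listed, with junk values beyond `m`. Indexing by
  -- numbers turns subpaths into intervals and their disjointness into an inequality.
  record Ear (S : Subset n) (a b : Fin n) : Set where
    field
      m         : ℕ
      p         : ℕ → Fin n
      injective : ∀ {i j} → i ≤ m → j ≤ m → p i ≡ p j → i ≡ j
      avoids    : ∀ {i} → i ≤ m → p i ∉ S
      adjacent  : ∀ {i} → i < m → p i ~ p (suc i)
      a∈S       : a ∈ S
      b∈S       : b ∈ S
      first     : p 0 ~ a
      last      : p m ~ b

  module _ {S a b} (E : Ear S a b) where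
    open Ear E

    Arc : ℕ → ℕ → Pred (Fin n) 0ℓ
    Arc i j x = ∃[ k ] i ≤ k × k ≤ j × x ≡ p k

    trail : ℕ → Subset n
    trail zero    = ⁅ p 0 ⁆
    trail (suc k) = trail k ∪ ⁅ p (suc k) ⁆

    ∈trail⁻ : ∀ k {x} → x ∈ trail k → Arc 0 k x
    ∈trail⁻ zero    x∈ = 0 , z≤n , z≤n , x∈⁅y⁆⇒x≡y _ x∈
    ∈trail⁻ (suc k) x∈ with x∈p∪q⁻ (trail k) _ x∈
    ... | inj₁ x∈t = let (i , 0≤i , i≤k , eq) = ∈trail⁻ k x∈t in i , 0≤i , ≤-trans i≤k (n≤1+n k) , eq
    ... | inj₂ x∈s = suc k , z≤n , ≤-refl , x∈⁅y⁆⇒x≡y _ x∈s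

    ∈trail⁺ : ∀ {i k} → i ≤′ k → p i ∈ trail k
    ∈trail⁺ {zero}  ≤′-refl = x∈⁅x⁆ _
    ∈trail⁺ {suc i} ≤′-refl = x∈p∪q⁺ (inj₂ (x∈⁅x⁆ _))
    ∈trail⁺ (≤′-step i≤k)   = x∈p∪q⁺ (inj₁ (∈trail⁺ i≤k))

    ear-extension : Subset n
    ear-extension = S ∪ trail m

    private
      S⊆ : ∀ {x} → x ∈ S → x ∈ ear-extension
      S⊆ = p⊆p∪q (trail m)

    Arc⊆ : ∀ {i j x} → j ≤ m → Arc i j x → x ∈ ear-extension
    Arc⊆ j≤m (k , _ , k≤j , refl) = x∈p∪q⁺ (inj₂ (∈trail⁺ (≤⇒≤′ (≤-trans k≤j j≤m))))

    Arc∩S : ∀ {i j x} → j ≤ m → Arc i j x → x ∉ S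
    Arc∩S j≤m (k , _ , k≤j , refl) = avoids (≤-trans k≤j j≤m)

    Arc∩Arc : ∀ {i j i′ j′ x} → j < i′ → j′ ≤ m → Arc i j x → ¬ Arc i′ j′ x
    Arc∩Arc j<i′ j′≤m (k , _ , k≤j , refl) (l , i′≤l , l≤j′ , eq) with injective k≤m (≤-trans l≤j′ j′≤m) eq
      where k≤m = ≤-trans k≤j (≤-trans (<⇒≤ j<i′) (≤-trans i′≤l (≤-trans l≤j′ j′≤m)))
    ... | refl = <⇒≱ j<i′ (≤-trans i′≤l k≤j)

    module _ {g : Marking n} (unmarked : ∀ {i} → i < m → at g (p i) (p (suc i)) ≡ false) where

      arc : ∀ {i j} → i ≤′ j → j ≤ m → Walk g (Arc i j) (p i) (p j)
      arc ≤′-refl             _   = stop (_ , ≤-refl , ≤-refl , refl)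
      arc (≤′-step {j} i≤j) j<m = snoc
        (widen (λ (k , i≤k , k≤j , eq) → k , i≤k , ≤-trans k≤j (n≤1+n j) , eq) (λ _ _ → refl) (arc i≤j (<⇒≤ j<m)))
        (adjacent j<m) (unmarked j<m) (suc j , ≤′⇒≤ (≤′-step i≤j) , ≤-refl , refl)

    module _ {g : Marking n}
             (S-S : ∀ {u v} → u ≢ v → u ∈ S → v ∈ S → Split g (_∈ ear-extension) u v)
             (E-S : ∀ {i v} → i ≤ m → v ∈ S → Split g (_∈ ear-extension) (p i) v)
             (E-E : ∀ {i j} → i < j → j ≤ m → Split g (_∈ ear-extension) (p i) (p j)) where

      split-cases : ∀ {u v} → u ≢ v → u ∈ ear-extension → v ∈ ear-extension →
                    Split g (_∈ ear-extension) u v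
      split-cases u≢v u∈ v∈ with x∈p∪q⁻ S (trail m) u∈ | x∈p∪q⁻ S (trail m) v∈
      ... | inj₁ u∈S | inj₁ v∈S = S-S u≢v u∈S v∈S
      ... | inj₁ u∈S | inj₂ v∈t with ∈trail⁻ m v∈t
      ...   | i , _ , i≤m , refl = split-flip (E-S i≤m u∈S)
      split-cases u≢v u∈ v∈ | inj₂ u∈t | inj₁ v∈S with ∈trail⁻ m u∈t
      ...   | i , _ , i≤m , refl = E-S i≤m v∈S
      split-cases u≢v u∈ v∈ | inj₂ u∈t | inj₂ v∈t with ∈trail⁻ m u∈t | ∈trail⁻ m v∈t
      ...   | i , _ , i≤m , refl | j , _ , j≤m , refl with <-cmp i j
      ...     | tri< i<j _ _  = E-E i<j j≤m
      ...     | tri≈ _ refl _ = contradiction refl u≢v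
      ...     | tri> _ _ j<i  = split-flip (E-E j<i i≤m)

    -- Any vertex of the ear reaches an endpoint of the ear along either arc, so
    -- a path with a marked edge between the two endpoints can be completed.
    open-ear : ∀ {f} → a ≢ b → Good f S → Good (glue S f plain) ear-extension
    open-ear {f} a≢b good = record
      { joined = λ u∈ v∈ → to-a u∈ ⋆ flip (to-a v∈)
      ; split  = split-cases
          (λ u≢v u∈ v∈ → split-widen S⊆ (λ _ _ → refl) (old (split good u≢v u∈ v∈))) ear-S ear-ear }
      where
      g = glue S f plain
      off : ∀ {i v} → i ≤ m → at g (p i) v ≡ false
      off i≤m = glue-outsideˡ S f plain (avoids i≤m)
      arc′ : ∀ {i j} → i ≤ j → j ≤ m → Walk g (Arc i j) (p i) (p j)
      arc′ i≤j = arc (off ∘ <⇒≤) (≤⇒≤′ i≤j)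
      old : ∀ {u v} → Split f (_∈ S) u v → Split g (_∈ S) u v
      old = split-widen id (λ x y → sym (glue-inside S f plain x y))
      to-a : ∀ {u} → u ∈ ear-extension → Walk g (_∈ ear-extension) u a
      to-a u∈ with x∈p∪q⁻ S (trail m) u∈
      ... | inj₁ u∈S = widen S⊆ (λ x y → sym (glue-inside S f plain x y)) (joined good u∈S a∈S)
      ... | inj₂ u∈t with ∈trail⁻ m u∈t
      ... | i , _ , i≤m , refl =
        snoc (widen (Arc⊆ i≤m) (λ _ _ → refl) (flip (arc′ z≤n i≤m))) first (off z≤n) (S⊆ a∈S)
      ear-S : ∀ {i v} → i ≤ m → v ∈ S → Split g (_∈ ear-extension) (p i) v
      ear-S {i} {v} i≤m v∈S with a ≟ v
      ... | no a≢v   = prolong S⊆ (Arc⊆ i≤m) (Arc∩S i≤m) (flip (arc′ z≤n i≤m)) first (off z≤n)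
                         (old (split good a≢v a∈S v∈S))
      ... | yes refl = prolong S⊆ (Arc⊆ ≤-refl) (Arc∩S ≤-refl) (arc′ i≤m ≤-refl) last (off ≤-refl)
                         (old (split good (≢-sym a≢b) b∈S a∈S))
      ear-ear : ∀ {i j} → i < j → j ≤ m → Split g (_∈ ear-extension) (p i) (p j)
      ear-ear {i} {j} i<j j≤m = split-flip (prolong {S = λ x → x ∈ S ⊎ Arc 0 i x}
          (λ { (inj₁ x) → S⊆ x ; (inj₂ x) → Arc⊆ i≤m x })
          (Arc⊆ ≤-refl) (λ { X (inj₁ x) → Arc∩S ≤-refl X x ; X (inj₂ Y) → Arc∩Arc i<j ≤-refl Y X })
          (arc′ j≤m ≤-refl) last (off ≤-refl)
          (split-flip (prolong inj₁ inj₂ (Arc∩S i≤m) (flip (arc′ z≤n i≤m)) first (off z≤n)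
            (old (split good a≢b a∈S b∈S)))))
        where i≤m = ≤-trans (<⇒≤ i<j) j≤m

  module _ {S a} (E : Ear S a a) where
    open Ear E

    -- With one attachment vertex no split of `S` can be routed through, so the ear carries its own
    -- mark: downwards it reaches `S` through the marked edge `p 0 ~ a`, upwards through the
    -- unmarked edge `p m ~ a`. For `i < j`, going down from `p i` and returning to `p j` from above
    -- uses disjoint arcs. The condition `0 < m` keeps these two edges apart.
    closed-ear : ∀ {f} → 0 < m → Good f S → Good (glue S f (single a (p 0))) (ear-extension E)
    closed-ear {f} 0<m good = record
      { joined = λ u∈ v∈ → to-a u∈ ⋆ flip (to-a v∈)
      ; split  = split-cases E
          (λ u≢v u∈ v∈ → split-widen S⊆ (λ x y → sym (glue-inside S f t x y)) (split good u≢v u∈ v∈))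
          ear-S ear-ear }
      where
      t = single a (p 0)
      g = glue S f t
      S⊆ : ∀ {x} → x ∈ S → x ∈ ear-extension E
      S⊆ = p⊆p∪q (trail E m)
      ≢a : ∀ {i} → i ≤ m → p i ≢ a
      ≢a i≤m eq = avoids i≤m (subst (_∈ S) (sym eq) a∈S)
      off : ∀ {i} → i < m → at g (p i) (p (suc i)) ≡ false
      off i<m = trans (glue-outsideˡ S f t (avoids (<⇒≤ i<m)))
        (single-elsewhere (inj₁ (≢a (<⇒≤ i<m))) (inj₂ (≢a i<m)))
      off-last : at g (p m) a ≡ false
      off-last = trans (glue-outsideˡ S f t (avoids ≤-refl))
        (single-elsewhere {v = a} (inj₁ (≢a ≤-refl))
          (inj₁ λ eq → <⇒≱ 0<m (ℕ.≤-reflexive (injective ≤-refl z≤n eq))))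
      on-first : at g (p 0) a ≡ true
      on-first = trans (glue-outsideˡ S f t (avoids z≤n)) (single-here a (p 0))
      arc′ : ∀ {i j} → i ≤ j → j ≤ m → Walk g (Arc E i j) (p i) (p j)
      arc′ i≤j = arc E off (≤⇒≤′ i≤j)
      old : ∀ {u v} → u ∈ S → v ∈ S → Walk g (_∈ S) u v
      old u∈S v∈S = widen id (λ x y → sym (glue-inside S f t x y)) (joined good u∈S v∈S)
      to-a : ∀ {u} → u ∈ ear-extension E → Walk g (_∈ ear-extension E) u a
      to-a u∈ with x∈p∪q⁻ S (trail E m) u∈
      ... | inj₁ u∈S = widen S⊆ (λ _ _ → refl) (old u∈S a∈S)
      ... | inj₂ u∈t with ∈trail⁻ E m u∈t
      ... | i , _ , i≤m , refl =
        snoc (widen (Arc⊆ E ≤-refl) (λ _ _ → refl) (arc′ i≤m ≤-refl)) last off-last (S⊆ a∈S)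
      ear-S : ∀ {i v} → i ≤ m → v ∈ S → Split g (_∈ ear-extension E) (p i) v
      ear-S i≤m v∈S = record
        { A⊆S = Arc⊆ E i≤m ; B⊆S = S⊆ ; disjoint = Arc∩S E i≤m
        ; edge = first ; marked = on-first
        ; left = flip (arc′ z≤n i≤m) ; right = old a∈S v∈S }
      ear-ear : ∀ {i j} → i < j → j ≤ m → Split g (_∈ ear-extension E) (p i) (p j)
      ear-ear {i} {j} i<j j≤m = record
        { A = Arc E 0 i ; B = λ x → x ∈ S ⊎ Arc E j m x
        ; A⊆S = Arc⊆ E i≤m ; B⊆S = [ S⊆ , Arc⊆ E ≤-refl ]′
        ; disjoint = λ { X (inj₁ x) → Arc∩S E i≤m X x ; X (inj₂ Y) → Arc∩Arc E i<j ≤-refl X Y }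
        ; edge = first ; marked = on-first
        ; left = flip (arc′ z≤n i≤m)
        ; right = flip (snoc (widen inj₂ (λ _ _ → refl) (arc′ j≤m ≤-refl)) last off-last (inj₁ a∈S)) }
        where i≤m = ≤-trans (<⇒≤ i<j) j≤m

  -- Joining two sets across a bridge

  record Semi (f : Marking n) (S : Subset n) : Set₁ where
    field
      joined : ∀ {u v} → u ∈ S → v ∈ S → Walk f (_∈ S) u v
      split  : ∀ {u v} → u ≢ v → u ∈ S → v ∈ S → Split f (_∈ S) u v ⊎ u ~ v

  good⇒semi : ∀ {f S} → Good f S → Semi f S
  good⇒semi good = record { joined = joined good ; split = λ u≢v u∈ v∈ → inj₁ (split good u≢v u∈ v∈) }

  module _ {S T : Subset n} {f g : Marking n} {x y : Fin n}
           (S∩T : ∀ {z} → z ∈ S → z ∉ T) (x∈S : x ∈ S) (y∈T : y ∈ T) (e : x ~ y) where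

    private
      swap : ∀ {z} → z ∈ T → z ∉ S
      swap z∈T z∈S = S∩T z∈S z∈T

    -- An unmarked bridge: only its two ends fail to be joined through a marked edge.
    bridge-semi : Good f S → Good g T → Semi (glue S f (glue T g plain)) (S ∪ T)
    bridge-semi gS gT = record
      { joined = λ u∈ v∈ → to-x u∈ ⋆ flip (to-x v∈) ; split = split′ }
      where
      h = glue S f (glue T g plain)
      h≗f : ∀ {u v} → u ∈ S → v ∈ S → at f u v ≡ at h u v
      h≗f u∈ v∈ = sym (glue-inside S f (glue T g plain) u∈ v∈)
      h≗g : ∀ {u v} → u ∈ T → v ∈ T → at g u v ≡ at h u v
      h≗g {v = v} u∈ v∈ = sym (trans (glue-outsideˡ S f (glue T g plain) {v = v} (swap u∈)) (glue-inside T g plain u∈ v∈))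
      off : at h x y ≡ false
      off = trans (glue-outsideʳ S f (glue T g plain) {u = x} (swap y∈T)) (glue-outsideˡ T g plain {v = y} (S∩T x∈S))
      off′ : at h y x ≡ false
      off′ = trans (at-sym h y x) off
      S⊆ : ∀ {z} → z ∈ S → z ∈ S ∪ T
      S⊆ = p⊆p∪q T
      T⊆ : ∀ {z} → z ∈ T → z ∈ S ∪ T
      T⊆ = q⊆p∪q S T
      to-x : ∀ {u} → u ∈ S ∪ T → Walk h (_∈ S ∪ T) u x
      to-x u∈ with x∈p∪q⁻ S T u∈
      ... | inj₁ u∈S = widen S⊆ h≗f (joined gS u∈S x∈S)
      ... | inj₂ u∈T = snoc (widen T⊆ h≗g (joined gT u∈T y∈T)) (~-sym e) off′ (S⊆ x∈S)
      across : ∀ {u v} → u ∈ S → v ∈ T → Split h (_∈ S ∪ T) u v ⊎ u ~ v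
      across {u} {v} u∈S v∈T with u ≟ x | v ≟ y
      ... | yes refl | yes refl = inj₂ e
      ... | no u≢x   | _        = inj₁ (split-flip (prolong S⊆ T⊆ swap (widen id h≗g (joined gT v∈T y∈T))
                                    (~-sym e) off′ (split-widen id h≗f (split gS (≢-sym u≢x) x∈S u∈S))))
      ... | yes refl | no v≢y   = inj₁ (prolong T⊆ S⊆ S∩T (stop x∈S) e off
                                    (split-widen id h≗g (split gT (≢-sym v≢y) y∈T v∈T)))
      split′ : ∀ {u v} → u ≢ v → u ∈ S ∪ T → v ∈ S ∪ T → Split h (_∈ S ∪ T) u v ⊎ u ~ v
      split′ u≢v u∈ v∈ with x∈p∪q⁻ S T u∈ | x∈p∪q⁻ S T v∈
      ... | inj₁ u∈S | inj₁ v∈S = inj₁ (split-widen S⊆ h≗f (split gS u≢v u∈S v∈S))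
      ... | inj₂ u∈T | inj₂ v∈T = inj₁ (split-widen T⊆ h≗g (split gT u≢v u∈T v∈T))
      ... | inj₁ u∈S | inj₂ v∈T = across u∈S v∈T
      ... | inj₂ u∈T | inj₁ v∈S with across v∈S u∈T
      ...   | inj₁ s = inj₁ (split-flip s)
      ...   | inj₂ d = inj₂ (~-sym d)

    -- A pair on opposite sides takes its mark from the edge `x ~ y` and needs nothing but unmarked
    -- walks to its ends. A pair on the same side is settled there, by a split or by its own edge,
    -- so semi-goodness suffices.
    bridge-colourable : (∀ z → z ∈ S ⊎ z ∈ T) → Semi f S → Semi g T → CfColourable G 2
    bridge-colourable cover sS sT = paint h , connect
      where
      -- All pairs between `S` and `T` are marked by `full`, but the paths used below cross only at
      -- `x ~ y`.
      h = glue S f (glue T g full)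
      h≗f : ∀ {u v} → u ∈ S → v ∈ S → at f u v ≡ at h u v
      h≗f u∈ v∈ = sym (glue-inside S f (glue T g full) u∈ v∈)
      h≗g : ∀ {u v} → u ∈ T → v ∈ T → at g u v ≡ at h u v
      h≗g {v = v} u∈ v∈ = sym (trans (glue-outsideˡ S f (glue T g full) {v = v} (swap u∈)) (glue-inside T g full u∈ v∈))
      on : at h x y ≡ true
      on = trans (glue-outsideʳ S f (glue T g full) {u = x} (swap y∈T)) (glue-outsideˡ T g full {v = y} (S∩T x∈S))
      across : ∀ {u v} → u ∈ S → v ∈ T → Split h (_∈ ⊤) u v
      across u∈S v∈T = record
        { A⊆S = λ _ → ∈⊤ ; B⊆S = λ _ → ∈⊤ ; disjoint = S∩T ; edge = e ; marked = on
        ; left  = widen id h≗f (Semi.joined sS u∈S x∈S)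
        ; right = widen id h≗g (Semi.joined sT y∈T v∈T) }
      within : ∀ {k R u v} → (∀ {u v} → u ∈ R → v ∈ R → at k u v ≡ at h u v) →
               Split k (_∈ R) u v ⊎ u ~ v → ConflictFreePath h u v
      within h≗k (inj₁ s) = split⇒path (split-widen id h≗k s)
      within h≗k (inj₂ d) = edge⇒path d
      connect : ConflictFreeConnected G (paint h)
      connect u v u≢v with cover u | cover v
      ... | inj₁ u∈S | inj₁ v∈S = within h≗f (Semi.split sS u≢v u∈S v∈S)
      ... | inj₂ u∈T | inj₂ v∈T = within h≗g (Semi.split sT u≢v u∈T v∈T)
      ... | inj₁ u∈S | inj₂ v∈T = split⇒path (across u∈S v∈T)
      ... | inj₂ u∈T | inj₁ v∈S = split⇒path (split-flip (across v∈S u∈T))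

  good-colourable : ∀ {f S} → (∀ z → z ∈ S) → Good f S → CfColourable G 2
  good-colourable {f} all good = paint f , λ u v u≢v → split⇒path (split good u≢v (all u) (all v))

-- Finite sums, counting, and sets given by lists

⟦_⟧ : ∀ {P : Set} → Dec P → ℕ
⟦ P? ⟧ = if does P? then 1 else 0

module _ {A : Set} where

  ∑ : (A → ℕ) → List A → ℕ
  ∑ f xs = sum (map f xs)

  ∑-+ : ∀ f g xs → ∑ (λ x → f x + g x) xs ≡ ∑ f xs + ∑ g xs
  ∑-+ f g []       = refl
  ∑-+ f g (x ∷ xs) = trans (cong (f x + g x +_) (∑-+ f g xs)) (interchange (f x) (g x) _ _)
    where
    interchange : ∀ a b c d → (a + b) + (c + d) ≡ (a + c) + (b + d)
    interchange = solve-∀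

  ∑-mono : ∀ {f g} → (∀ x → f x ≤ g x) → ∀ xs → ∑ f xs ≤ ∑ g xs
  ∑-mono f≤g []       = z≤n
  ∑-mono f≤g (x ∷ xs) = +-mono-≤ (f≤g x) (∑-mono f≤g xs)

  ∑-cong : ∀ {f g} → (∀ x → f x ≡ g x) → ∀ xs → ∑ f xs ≡ ∑ g xs
  ∑-cong f≗g xs = cong sum (map-cong f≗g xs)

  ∑-const-0 : ∀ xs → ∑ (λ _ → 0) xs ≡ 0
  ∑-const-0 []       = refl
  ∑-const-0 (_ ∷ xs) = ∑-const-0 xs

  ∑-const-1 : ∀ xs → ∑ (λ _ → 1) xs ≡ length xs
  ∑-const-1 []       = refl
  ∑-const-1 (x ∷ xs) = cong suc (∑-const-1 xs)

  ∑-swap : ∀ {B : Set} (f : A → B → ℕ) xs ys →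
           sum (map (λ y → ∑ (λ x → f x y) xs) ys) ≡ ∑ (λ x → sum (map (f x) ys)) xs
  ∑-swap f xs []       = sym (∑-const-0 xs)
  ∑-swap f xs (y ∷ ys) =
    trans (cong (∑ (λ x → f x y) xs +_) (∑-swap f xs ys)) (sym (∑-+ _ _ xs))

  ∑-⊆ : ∀ f {xs ys} → Unique xs → xs ⊆ₗ ys → ∑ f xs ≤ ∑ f ys
  ∑-⊆ f []         _     = z≤n
  ∑-⊆ f {x ∷ xs} (x∉ ∷ uq) xs⊆ys with ∈-∃++ (xs⊆ys (here refl))
  ... | ls , rs , refl = ≤-trans (ℕ.+-monoʳ-≤ (f x) (∑-⊆ f uq rest))
                           (ℕ.≤-reflexive (sym (sum-↭ (map⁺ f (shift x ls rs)))))
    where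
    rest : xs ⊆ₗ ls ++ rs
    rest y∈xs with ∈-resp-↭ (shift x ls rs) (xs⊆ys (there y∈xs))
    ... | here refl = contradiction refl (All.lookup x∉ y∈xs)
    ... | there y∈  = y∈

  count : ∀ {P : Pred A 0ℓ} → Decidable P → List A → ℕ
  count P? xs = length (filter P? xs)

  count≡∑ : ∀ {P : Pred A 0ℓ} (P? : Decidable P) xs → count P? xs ≡ ∑ (λ x → ⟦ P? x ⟧) xs
  count≡∑ P? []       = refl
  count≡∑ P? (x ∷ xs) with P? x
  ... | yes _ = cong suc (count≡∑ P? xs)
  ... | no  _ = count≡∑ P? xs

  count≤1 : ∀ {P : Pred A 0ℓ} (P? : Decidable P) {xs} → Unique xs →
            (∀ {x y} → P x → P y → x ≡ y) → count P? xs ≤ 1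
  count≤1 P? {xs} uq P! with filter P? xs in eq | Unique.filter⁺ P? uq
  ... | []        | _ = z≤n
  ... | _ ∷ []    | _ = ≤-refl
  ... | x ∷ y ∷ _ | (x≢y ∷ _) ∷ _ = contradiction (P! (P-at (here refl)) (P-at (there (here refl)))) x≢y
    where
    P-at : ∀ {z} → z List.∈ x ∷ y ∷ _ → _
    P-at z∈ = proj₂ (∈-filter⁻ P? {xs = xs} (subst (_ List.∈_) (sym eq) z∈))

  count≡0 : ∀ {P : Pred A 0ℓ} (P? : Decidable P) xs → (∀ {x} → ¬ P x) → count P? xs ≤ 0
  count≡0 P? []       ¬P = z≤n
  count≡0 P? (x ∷ xs) ¬P with P? x
  ... | yes Px = contradiction Px ¬P
  ... | no  _  = count≡0 P? xs ¬P

minimum-≤ : ∀ {m ks k} → [ m ] ≤∞ minimum ks → k List.∈ ks → m ≤ k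
minimum-≤ {ks = ks} m≤ k∈ = [≤]-injective (≤⁺-trans ≤-trans m≤
  (All.lookup (Extrema.min≤xs ≤∞-totalOrder _ (map [_] ks)) (∈-map⁺ [_] k∈)))

∈-allSubsets : ∀ {n} (S : Subset n) → S List.∈ allSubsets n
∈-allSubsets []            = here refl
∈-allSubsets (inside  ∷ S) = ∈-++⁺ˡ (∈-map⁺ (inside ∷_) (∈-allSubsets S))
∈-allSubsets {suc n} (outside ∷ S) =
  ∈-++⁺ʳ (map (inside ∷_) (allSubsets n)) (∈-map⁺ (outside ∷_) (∈-allSubsets S))

∣⁅x⁆∪p∣ : ∀ {n} x (p : Subset n) → x ∉ p → ∣ ⁅ x ⁆ ∪ p ∣ ≡ suc ∣ p ∣
∣⁅x⁆∪p∣ zero    (inside  ∷ p) x∉p = contradiction here x∉p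
∣⁅x⁆∪p∣ zero    (outside ∷ p) x∉p = cong (suc ∘ ∣_∣) (∪-identityˡ p)
∣⁅x⁆∪p∣ (suc x) (inside  ∷ p) x∉p = cong suc (∣⁅x⁆∪p∣ x p (x∉p ∘ there))
∣⁅x⁆∪p∣ (suc x) (outside ∷ p) x∉p = ∣⁅x⁆∪p∣ x p (x∉p ∘ there)

⋃⁅_⁆ : ∀ {n} → List (Fin n) → Subset n
⋃⁅ [] ⁆     = Subset.⊥
⋃⁅ v ∷ vs ⁆ = ⁅ v ⁆ ∪ ⋃⁅ vs ⁆

∈⋃⁻ : ∀ {n} (vs : List (Fin n)) {x} → x ∈ ⋃⁅ vs ⁆ → x List.∈ vs
∈⋃⁻ []       x∈ = contradiction x∈ ∉⊥
∈⋃⁻ (v ∷ vs) x∈ with x∈p∪q⁻ ⁅ v ⁆ _ x∈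
... | inj₁ x∈v = here (x∈⁅y⁆⇒x≡y v x∈v)
... | inj₂ x∈⋃ = there (∈⋃⁻ vs x∈⋃)

∣⋃∣ : ∀ {n} {vs : List (Fin n)} → Unique vs → ∣ ⋃⁅ vs ⁆ ∣ ≡ length vs
∣⋃∣ {n} []     = ∣⊥∣≡0 n
∣⋃∣ {vs = v ∷ vs} (v∉ ∷ uq) =
  trans (∣⁅x⁆∪p∣ v _ (λ v∈ → All.lookup v∉ (∈⋃⁻ vs v∈) refl)) (cong suc (∣⋃∣ uq))

-- Degree sums and codegrees of independent sets

module _ {n : ℕ} (G : Graph n) where
  open Graph G

  -- Independent sets as lists without repetition: sums over the set recurse on the list, and a
  -- concrete set of four vertices is given by its six pairs.
  Spread : List (Fin n) → Set
  Spread = AllPairs (λ u v → u ≢ v × ¬ u ~ v)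

  spread⇒≁ : ∀ {vs u v} → Spread vs → u List.∈ vs → v List.∈ vs → ¬ u ~ v
  spread⇒≁ (_  ∷ _)  (here refl) (here refl) = ~-irrefl refl
  spread⇒≁ (ps ∷ _)  (here refl) (there v∈)  = proj₂ (All.lookup ps v∈)
  spread⇒≁ (ps ∷ _)  (there u∈)  (here refl) = proj₂ (All.lookup ps u∈) ∘ ~-sym
  spread⇒≁ (_  ∷ sp) (there u∈)  (there v∈)  = spread⇒≁ sp u∈ v∈

  spread⇒unique : ∀ {vs} → Spread vs → Unique vs
  spread⇒unique = AllPairs.map proj₁

  σ≤∑deg : ∀ {m vs} → [ m ] ≤∞ σ G (length vs) → Spread vs → m ≤ ∑ (deg G) vs
  σ≤∑deg {vs = vs} m≤ sp = ≤-trans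
    (minimum-≤ m≤ (∈-map⁺ (degreeSum G) (∈-filter⁺ _ (∈-allSubsets ⋃⁅ vs ⁆)
      ((λ u v u∈ v∈ → spread⇒≁ sp (∈⋃⁻ vs u∈) (∈⋃⁻ vs v∈)) , ∣⋃∣ (spread⇒unique sp)))))
    -- `degreeSum` lists the same vertices in the order of `allFin n`; comparing by containment
    -- avoids relating the two orders.
    (∑-⊆ (deg G) (Unique.filter⁺ (_∈? ⋃⁅ vs ⁆) (Unique.allFin⁺ n))
      (λ x∈ → ∈⋃⁻ vs (proj₂ (∈-filter⁻ (_∈? ⋃⁅ vs ⁆) {xs = allFin n} x∈))))

  δ≤deg : ∀ {m} → [ m ] ≤∞ δ G → ∀ v → m ≤ deg G v
  δ≤deg m≤ v = minimum-≤ m≤ (∈-map⁺ (deg G) (∈-allFin v))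

  common? : ∀ u v → Decidable (λ w → u ~ w × v ~ w)
  common? u v w = (u ~? w) ×-dec (v ~? w)

  codeg : Fin n → Fin n → ℕ
  codeg u v = count (common? u v) (allFin n)

  codegSum : List (Fin n) → ℕ
  codegSum []       = 0
  codegSum (v ∷ vs) = ∑ (codeg v) vs + codegSum vs

  private
    adj eq : Fin n → Fin n → ℕ
    adj v w = ⟦ v ~? w ⟧
    eq  v w = ⟦ v ≟ w ⟧

    coadj : List (Fin n) → Fin n → ℕ
    coadj []       w = 0
    coadj (v ∷ vs) w = ∑ (λ u → ⟦ common? v u w ⟧) vs + coadj vs w

    ∑-zero : ∀ {P : Fin n → Set} (P? : ∀ v → Dec (P v)) {vs} → All (¬_ ∘ P) vs → ∑ (λ v → ⟦ P? v ⟧) vs ≡ 0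
    ∑-zero P? [] = refl
    ∑-zero P? {v ∷ _} (¬p ∷ ps) rewrite dec-false (P? v) ¬p = ∑-zero P? ps

    -- If `w` is the head, independence makes every other term on the left vanish. If the head is
    -- adjacent to `w`, each later neighbour of `w` forms with the head a pair having `w` in common,
    -- which pays for it. Otherwise the head contributes nothing on the left.
    pointwise : ∀ {vs} → Spread vs → ∀ w →
                ∑ (λ v → adj v w) vs + ∑ (λ v → eq v w) vs ≤ 1 + coadj vs w
    pointwise []              w = z≤n
    pointwise {v ∷ vs} (ps ∷ sp) w with v ~? w | v ≟ w
    ... | yes v~w | yes refl = contradiction v~w (~-irrefl refl)
    ... | no _    | yes refl
      rewrite ∑-zero (_~? w) (All.map (λ (_ , v≁u) → v≁u ∘ ~-sym) ps)
            | ∑-zero (_≟ w) (All.map (λ (v≢u , _) → ≢-sym v≢u) ps) = s≤s z≤n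
    ... | yes v~w | no _
      rewrite ∑-zero (_≟ w) {vs} (All.map (λ { (_ , v≁u) refl → v≁u v~w }) ps)
            | ℕ.+-identityʳ (∑ (λ u → adj u w) vs) = s≤s (ℕ.m≤m+n _ _)
    ... | no _    | no _     = ≤-trans (pointwise sp w) (s≤s (ℕ.m≤n+m _ _))

    ∑coadj : ∀ vs → ∑ (coadj vs) (allFin n) ≡ codegSum vs
    ∑coadj []       = ∑-const-0 (allFin n)
    ∑coadj (v ∷ vs) = trans (∑-+ _ (coadj vs) (allFin n))
      (cong₂ _+_ (trans (∑-swap (λ u w → ⟦ common? v u w ⟧) vs (allFin n))
                        (∑-cong (λ u → sym (count≡∑ (common? v u) (allFin n))) vs))
                 (∑coadj vs))

  -- Count, over all w, the members of the independent set equal or adjacent to w: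
  -- a vertex adjacent to k of them is common to k(k−1)/2 ≥ k − 1 pairs.
  ∑deg≤ : ∀ {vs} → Spread vs → ∑ (deg G) vs + length vs ≤ n + codegSum vs
  ∑deg≤ {vs} sp = begin
    ∑ (deg G) vs + length vs
      ≡⟨ cong (∑ (deg G) vs +_) (∑-const-1 vs) ⟨
    ∑ (deg G) vs + ∑ (λ _ → 1) vs
      ≤⟨ ℕ.+-monoʳ-≤ (∑ (deg G) vs) (∑-mono self vs) ⟩
    ∑ (deg G) vs + ∑ (λ v → count (v ≟_) (allFin n)) vs
      ≡⟨ cong₂ _+_ (∑-cong (λ v → count≡∑ (v ~?_) (allFin n)) vs)
                   (∑-cong (λ v → count≡∑ (v ≟_) (allFin n)) vs) ⟩
    ∑ (λ v → ∑ (adj v) (allFin n)) vs + ∑ (λ v → ∑ (eq v) (allFin n)) vs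
      ≡⟨ cong₂ _+_ (∑-swap adj vs (allFin n)) (∑-swap eq vs (allFin n)) ⟨
    ∑ (λ w → ∑ (λ v → adj v w) vs) (allFin n) + ∑ (λ w → ∑ (λ v → eq v w) vs) (allFin n)
      ≡⟨ ∑-+ _ _ (allFin n) ⟨
    ∑ (λ w → ∑ (λ v → adj v w) vs + ∑ (λ v → eq v w) vs) (allFin n)
      ≤⟨ ∑-mono (pointwise sp) (allFin n) ⟩
    ∑ (λ w → 1 + coadj vs w) (allFin n)
      ≡⟨ ∑-+ _ _ (allFin n) ⟩
    ∑ (λ _ → 1) (allFin n) + ∑ (coadj vs) (allFin n)
      ≡⟨ cong₂ _+_ (trans (∑-const-1 (allFin n)) (length-tabulate id)) (∑coadj vs) ⟩
    n + codegSum vs ∎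
    where
    open ℕ.≤-Reasoning
    self : ∀ v → 1 ≤ count (v ≟_) (allFin n)
    self v = filter-some (v ≟_) (∈-allFin v)

  -- The 4 counts the chosen vertices themselves in `∑deg≤`; the degree sum then cancels against
  -- `n`.
  codegSum≥4 : [ n ] ≤∞ σ G 4 → ∀ {a b c d} → Spread (a ∷ b ∷ c ∷ d ∷ []) →
               4 ≤ codegSum (a ∷ b ∷ c ∷ d ∷ [])
  codegSum≥4 σ≥n {a} {b} {c} {d} sp =
    ℕ.+-cancelˡ-≤ n 4 _ (≤-trans (ℕ.+-monoˡ-≤ 4 (σ≤∑deg σ≥n sp)) (∑deg≤ sp))

  another-neighbour : ∀ {u} → 2 ≤ deg G u → ∀ x → ∃[ w ] u ~ w × w ≢ x
  another-neighbour {u} 2≤d x with any? (λ w → (u ~? w) ×-dec ¬? (w ≟ x))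
  ... | yes found = found
  ... | no none   = contradiction (≤-trans 2≤d
    (count≤1 (u ~?_) (Unique.allFin⁺ n) λ {v} {w} u~v u~w → trans (only v u~v) (sym (only w u~w)))) λ { (s≤s ()) }
    where
    only : ∀ w → u ~ w → w ≡ x
    only w u~w = decidable-stable (w ≟ x) λ w≢x → none (w , u~w , w≢x)

∉─ : ∀ {n} (p q : Subset n) {x} → x ∈ p ─ q → x ∉ q
∉─ (_ ∷ p)       (_ ∷ q)       (there x∈) (there x∈q) = ∉─ p q x∈ x∈q
∉─ (_ ∷ p)       (inside ∷ q)  ()         here

-- A finite search that decides neither `P` nor `Q`. In `core` each vertex returns its branch or a
-- larger good set, so goodness itself need not be decided.
all-or : ∀ {a b n} {P : Fin n → Set a} {Q : Set b} → (∀ i → P i ⊎ Q) → (∀ i → P i) ⊎ Q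
all-or {n = zero}  pq = inj₁ λ ()
all-or {n = suc n} pq with pq zero | all-or (pq ∘ suc)
... | inj₂ q | _      = inj₂ q
... | inj₁ _ | inj₂ q = inj₂ q
... | inj₁ p | inj₁ ps = inj₁ λ { zero → p ; (suc i) → ps i }

-- Components outside a good set, and the bridges leading to them

module _ {n : ℕ} (G : Graph n) where
  open Graph G

  GoodSet : Subset n → Set₁
  GoodSet S = Σ[ f ∈ Marking n ] Good G f S

  module _ {U : Subset n} where

    -- The connected component of `z` in the subgraph induced on `U`. Under `plain` no pair is
    -- marked, so `linked` is ordinary connectivity inside `C`.
    record Component (z : Fin n) : Set where
      field
        C      : Subset n
        z∈C    : z ∈ C
        C⊆U    : C ⊆ U
        closed : ∀ {u v} → u ∈ C → v ∈ U → u ~ v → v ∈ C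
        linked : ∀ {w} → w ∈ C → Walk G plain (_∈ C) z w

    component : ∀ {z} → z ∈ U → Component z
    component {z} z∈U = grow ⁅ z ⁆ (⊃-wellFounded _) (x∈⁅x⁆ z)
        (λ w∈ → subst (_∈ U) (sym (x∈⁅y⁆⇒x≡y z w∈)) z∈U)
        (λ w∈ → subst (Walk G plain (_∈ ⁅ z ⁆) z) (sym (x∈⁅y⁆⇒x≡y z w∈)) (stop (x∈⁅x⁆ z)))
      where
      grow : ∀ C → Acc _⊃_ C → z ∈ C → C ⊆ U → (∀ {w} → w ∈ C → Walk G plain (_∈ C) z w) → Component z
      grow C (acc rs) z∈C C⊆U linked
        with any? (λ u → any? λ v → (u ∈? C) ×-dec ((v ∈? U) ×-dec (¬? (v ∈? C) ×-dec (u ~? v))))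
      ... | no closed = record
        { C = C ; z∈C = z∈C ; C⊆U = C⊆U ; linked = linked
        ; closed = λ {u} {v} u∈C v∈U u~v →
            decidable-stable (v ∈? C) λ v∉C → closed (u , v , u∈C , v∈U , v∉C , u~v) }
      ... | yes (u , v , u∈C , v∈U , v∉C , u~v) =
        grow (C ∪ ⁅ v ⁆) (rs (p⊆p∪q ⁅ v ⁆ , v , v∈ , v∉C)) (p⊆p∪q ⁅ v ⁆ z∈C)
          (λ w∈ → [ C⊆U , (λ w∈v → subst (_∈ U) (sym (x∈⁅y⁆⇒x≡y v w∈v)) v∈U) ]′ (x∈p∪q⁻ C ⁅ v ⁆ w∈))
          linked′
        where
        v∈ : v ∈ C ∪ ⁅ v ⁆
        v∈ = q⊆p∪q C ⁅ v ⁆ (x∈⁅x⁆ v)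
        old : ∀ {w} → w ∈ C → Walk G plain (_∈ C ∪ ⁅ v ⁆) z w
        old w∈ = widen G (p⊆p∪q ⁅ v ⁆) (λ _ _ → refl) (linked w∈)
        linked′ : ∀ {w} → w ∈ C ∪ ⁅ v ⁆ → Walk G plain (_∈ C ∪ ⁅ v ⁆) z w
        linked′ w∈ with x∈p∪q⁻ C ⁅ v ⁆ w∈
        ... | inj₁ w∈C = old w∈C
        ... | inj₂ w∈v = subst (Walk G plain _ z) (sym (x∈⁅y⁆⇒x≡y v w∈v)) (snoc G (old u∈C) u~v refl v∈)

    closed-walk : ∀ {z f A u w} (K : Component z) → (∀ {x} → A x → x ∈ U) →
                  Walk G f A u w → u ∈ Component.C K → w ∈ Component.C K
    closed-walk K A⊆U (stop _)         u∈C = u∈C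
    closed-walk K A⊆U (step _ e _ p) u∈C =
      closed-walk K A⊆U p (Component.closed K u∈C (A⊆U (start∈ G p)) e)

  -- A bridge y x, seen from the component C of y in the graph without it.
  record Side (C : Subset n) (y x : Fin n) : Set where
    field
      y∈C  : y ∈ C
      x∉C  : x ∉ C
      edge : y ~ x
      only : ∀ {u v} → u ∈ C → v ∉ C → u ~ v → u ≡ y × v ≡ x

  opposite : ∀ {C y x} → Side C y x → Side (∁ C) x y
  opposite s = record
    { y∈C = x∉p⇒x∈∁p x∉C ; x∉C = x∈p⇒x∉∁p y∈C ; edge = ~-sym edge
    ; only = λ u∈ v∉ e → let (p , q) = only (x∉∁p⇒x∈p v∉) (x∈∁p⇒x∉p u∈) (~-sym e) in q , p }
    where open Side s

  exit : ∀ {C z y} → Star _~_ z y → z ∈ C → y ∉ C → ∃[ u ] ∃[ v ] u ∈ C × v ∉ C × u ~ v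
  exit ε z∈C y∉C = contradiction z∈C y∉C
  exit {C} {z} (_◅_ {j = w} e p) z∈C y∉C with w ∈? C
  ... | yes w∈C = exit p w∈C y∉C
  ... | no  w∉C = z , w , z∈C , w∉C , e

  size : ∀ {u v} → Star _~_ u v → ℕ
  size ε       = 0
  size (_ ◅ p) = suc (size p)

  index : ∀ {u v} → Star _~_ u v → ℕ → Fin n
  index {u} p       zero    = u
  index {u} ε       (suc i) = u
  index     (_ ◅ p) (suc i) = index p i

  index-∈ : ∀ {u v} (p : Star _~_ u v) i → index p i List.∈ vertices G p
  index-∈ ε       zero    = here refl
  index-∈ ε       (suc i) = here refl
  index-∈ (_ ◅ p) zero    = here refl
  index-∈ (_ ◅ p) (suc i) = there (index-∈ p i)

  index-injective : ∀ {u v} (p : Star _~_ u v) → IsPath G p → ∀ {i j} → i ≤ size p → j ≤ size p →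
                    index p i ≡ index p j → i ≡ j
  index-injective ε       _          z≤n     z≤n     _  = refl
  index-injective (_ ◅ p) _          z≤n     z≤n     _  = refl
  index-injective (_ ◅ p) (u∉p ∷ _)  {j = suc j} z≤n (s≤s _) eq =
    contradiction eq (All.lookup u∉p (index-∈ p j))
  index-injective (_ ◅ p) (u∉p ∷ _)  {i = suc i} (s≤s _) z≤n eq =
    contradiction (sym eq) (All.lookup u∉p (index-∈ p i))
  index-injective (_ ◅ p) (_ ∷ uq)   (s≤s i≤) (s≤s j≤) eq = cong suc (index-injective p uq i≤ j≤ eq)

  index-adjacent : ∀ {u v} (p : Star _~_ u v) {i} → i < size p → index p i ~ index p (suc i)
  index-adjacent (e ◅ p) {zero}  _        = e
  index-adjacent (_ ◅ p) {suc i} (s≤s i<) = index-adjacent p i<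

  index-last : ∀ {u v} (p : Star _~_ u v) → index p (size p) ≡ v
  index-last ε       = refl
  index-last (_ ◅ p) = index-last p

  record Branch (D S : Subset n) (z : Fin n) : Set where
    field
      comp : Component {D ─ S} z
    open Component comp public
    field
      y x  : Fin n
      side : Side C y x
      x∈S  : x ∈ S

  -- Maximality of `S` among the good sets in `D` is recorded only through its consequence `branch`.
  record Core (D : Subset n) (r : Fin n) : Set₁ where
    field
      S      : Subset n
      r∈S    : r ∈ S
      S⊆D    : S ⊆ D
      good   : GoodSet S
      branch : ∀ z → z ∈ D → z ∉ S → Branch D S z

  module _ (connected : Connected G) where

    -- Two edges leaving a component of D ∖ S complete an ear of S.
    branch-or-ear : ∀ {D S r z} → (∀ {u v} → u ∈ D → u ∉ S → v ∉ D → ¬ u ~ v) → r ∈ S → S ⊆ D → GoodSet S →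
                    z ∈ D → z ∉ S → Branch D S z ⊎ (Σ[ T ∈ Subset n ] S ⊂ T × T ⊆ D × GoodSet T)
    branch-or-ear {D} {S} {r} {z} barrier r∈S S⊆D (f , good) z∈D z∉S
      with component {U = D ─ S} (x∈p∧x∉q⇒x∈p─q z∈D z∉S)
    ... | K = go
      where
      open Component K
      C⊆D : C ⊆ D
      C⊆D = p─q⊆p D S ∘ C⊆U
      C∩S : ∀ {u} → u ∈ C → u ∉ S
      C∩S = ∉─ D S ∘ C⊆U
      exit∈S : ∀ {u v} → u ∈ C → v ∉ C → u ~ v → v ∈ S
      exit∈S {u} {v} u∈C v∉C u~v with v ∈? S | v ∈? D
      ... | yes v∈S | _       = v∈S
      ... | no v∉S  | yes v∈D = contradiction (closed u∈C (x∈p∧x∉q⇒x∈p─q v∈D v∉S) u~v) v∉C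
      ... | no _    | no v∉D  = contradiction u~v (barrier (C⊆D u∈C) (C∩S u∈C) v∉D)
      module _ {u a v b} (u∈C : u ∈ C) (a∉C : a ∉ C) (u~a : u ~ a) (v∈C : v ∈ C) (b∉C : b ∉ C) (v~b : v ~ b) where
        open Simple (shorten G plain (_⋆_ G (flip G (linked u∈C)) (linked v∈C)))
        ear : Ear G S a b
        ear = record
          { m = size path ; p = index path
          ; injective = index-injective path isPath
          ; avoids = λ {i} _ → C∩S (All.lookup stays (index-∈ path i))
          ; adjacent = index-adjacent path
          ; a∈S = exit∈S u∈C a∉C u~a ; b∈S = exit∈S v∈C b∉C v~b
          ; first = u~a ; last = subst (_~ b) (sym (index-last path)) v~b }
        T = ear-extension G ear
        S⊂T : S ⊂ T
        S⊂T = p⊆p∪q _ , u , x∈p∪q⁺ (inj₂ (∈trail⁺ G ear {0} {size path} (ℕ.≤⇒≤′ z≤n))) , C∩S u∈C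
        T⊆D : T ⊆ D
        T⊆D t∈ with x∈p∪q⁻ S _ t∈
        ... | inj₁ t∈S = S⊆D t∈S
        ... | inj₂ t∈E with ∈trail⁻ G ear (size path) t∈E
        ... | i , _ , _ , refl = C⊆D (All.lookup stays (index-∈ path i))
        positive : u ≢ v → 0 < size path
        positive u≢v = ℕ.n≢0⇒n>0 λ eq → u≢v (trans (sym (cong (index path) eq)) (index-last path))
        extend : ¬ (v ≡ u × b ≡ a) → Σ[ T ∈ Subset n ] S ⊂ T × T ⊆ D × GoodSet T
        extend distinct with a ≟ b
        ... | no a≢b   = T , S⊂T , T⊆D , _ , open-ear G ear a≢b good
        ... | yes refl = T , S⊂T , T⊆D , _ ,
          closed-ear G ear (positive λ u≡v → distinct (sym u≡v , refl)) good
      go : Branch D S z ⊎ (Σ[ T ∈ Subset n ] S ⊂ T × T ⊆ D × GoodSet T)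
      go with exit (connected z r) z∈C (λ r∈C → C∩S r∈C r∈S)
      ... | y , x , y∈C , x∉C , y~x
        with any? (λ u → any? λ v →
          (u ∈? C) ×-dec (¬? (v ∈? C) ×-dec ((u ~? v) ×-dec ¬? ((u ≟ y) ×-dec (v ≟ x)))))
      ... | yes (u , v , u∈C , v∉C , u~v , ≢yx) = inj₂ (extend y∈C x∉C y~x u∈C v∉C u~v ≢yx)
      ... | no none = inj₁ record
        { comp = K ; y = y ; x = x ; x∈S = exit∈S y∈C x∉C y~x
        ; side = record
          { y∈C = y∈C ; x∉C = x∉C ; edge = y~x
          ; only = λ {u} {v} u∈C v∉C u~v → decidable-stable ((u ≟ y) ×-dec (v ≟ x))
              λ ≢yx → none (u , v , u∈C , v∉C , u~v , ≢yx) } }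

    -- The set `D` can be left only from `r`, which belongs to the growing set throughout. A
    -- component of the rest of `D` therefore has all its exits in the current good set, as an ear
    -- requires.
    core : ∀ {D r} → (∀ {u v} → u ∈ D → v ∉ D → u ~ v → u ≡ r) → r ∈ D → Core D r
    core {D} {r} gate r∈D = grow ⁅ r ⁆ (⊃-wellFounded _) (x∈⁅x⁆ r)
        (λ s∈ → subst (_∈ D) (sym (x∈⁅y⁆⇒x≡y r s∈)) r∈D) (plain , good-⁅⁆ G r)
      where
      grow : ∀ S → Acc _⊃_ S → r ∈ S → S ⊆ D → GoodSet S → Core D r
      grow S (acc rs) r∈S S⊆D good =
        [ (λ branches → record { S = S ; r∈S = r∈S ; S⊆D = S⊆D ; good = good ; branch = branches })
        , (λ (T , S⊂T , T⊆D , good′) → grow T (rs S⊂T) (proj₁ S⊂T r∈S) T⊆D good′)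
        ]′ (all-or try)
        where
        try : ∀ z → (z ∈ D → z ∉ S → Branch D S z) ⊎ (Σ[ T ∈ Subset n ] S ⊂ T × T ⊆ D × GoodSet T)
        try z with z ∈? D | z ∈? S
        ... | no z∉D  | _       = inj₁ λ z∈D → contradiction z∈D z∉D
        ... | yes _   | yes z∈S = inj₁ λ _ z∉S → contradiction z∈S z∉S
        ... | yes z∈D | no z∉S
          with branch-or-ear (λ u∈D u∉S v∉D u~v → u∉S (subst (_∈ S) (sym (gate u∈D v∉D u~v)) r∈S))
                 r∈S S⊆D good z∈D z∉S
        ...   | inj₁ b = inj₁ λ _ _ → b
        ...   | inj₂ t = inj₂ t

    side-core : ∀ {D y x} → Side D y x → Core D y
    side-core s = core (λ u∈D v∉D u~v → proj₁ (only u∈D v∉D u~v)) y∈C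
      where open Side s

    -- Passing to a branch of the core loses `y`, so sides shrink until one equals its core. Such a
    -- side is an end of the chain: a core in the middle could have two branches, whereas on the way
    -- from an end each core has at most one.
    leaf : ∀ {D y x} → Side D y x → Σ[ L ∈ Subset n ] ∃[ y ] ∃[ x ] Side L y x × GoodSet L
    leaf s = go s (⊂-wellFounded _)
      where
      go : ∀ {D y x} → Side D y x → Acc _⊂_ D → Σ[ L ∈ Subset n ] ∃[ y ] ∃[ x ] Side L y x × GoodSet L
      go {D} {y} {x} s (acc rs) with side-core s
      ... | K with any? (λ z → (z ∈? D) ×-dec ¬? (z ∈? Core.S K))
      ... | no none = D , y , x , s , subst GoodSet (⊆-antisym S⊆D
              λ {z} z∈D → decidable-stable (z ∈? S) λ z∉S → none (z , z∈D , z∉S)) good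
        where open Core K
      ... | yes (z , z∈D , z∉S) = go side
              (rs (p─q⊆p D S ∘ C⊆U , y , Side.y∈C s , λ y∈C → ∉─ D S (C⊆U y∈C) r∈S))
        where
        open Core K
        open Branch (branch z z∈D z∉S) hiding (y)

    -- The degree conditions exclude branching and long chains

    module _ (δ≥2 : [ 2 ] ≤∞ δ G) (σ≥n : [ n ] ≤∞ σ G 4) where

      -- Off the end of its bridge, the closed neighbourhood stays inside the side.
      interior : ∀ {C y x} → Side C y x → ∃[ v ] v ∈ C × (∀ {w} → v ~ w → w ∈ C)
      interior {C} {y} {x} s with another-neighbour G (δ≤deg G δ≥2 y) x
      ... | v , y~v , v≢x = v , v∈C , λ {w} v~w → decidable-stable (w ∈? C)
              λ w∉C → ~-irrefl (sym (proj₁ (only v∈C w∉C v~w))) y~v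
        where
        open Side s
        v∈C : v ∈ C
        v∈C = decidable-stable (v ∈? C) λ v∉C → v≢x (proj₂ (only y∈C v∉C y~v))

      codeg≤0 : ∀ u v → (∀ {w} → u ~ w → v ~ w → ⊥) → codeg G u v ≤ 0
      codeg≤0 u v none = count≡0 (common? G u v) (allFin n) λ (u~w , v~w) → none u~w v~w

      codeg≤1 : ∀ u v t → (∀ {w} → u ~ w → v ~ w → w ≡ t) → codeg G u v ≤ 1
      codeg≤1 u v t one = count≤1 (common? G u v) (Unique.allFin⁺ n)
        λ (u~w , v~w) (u~w′ , v~w′) → trans (one u~w v~w) (sym (one u~w′ v~w′))

      spread : ∀ {a b c d} → a ≢ b → ¬ a ~ b → a ≢ c → ¬ a ~ c → a ≢ d → ¬ a ~ d →
               b ≢ c → ¬ b ~ c → b ≢ d → ¬ b ~ d → c ≢ d → ¬ c ~ d →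
               Spread G (a ∷ b ∷ c ∷ d ∷ [])
      spread ab ab′ ac ac′ ad ad′ bc bc′ bd bd′ cd cd′ =
        ((ab , ab′) ∷ (ac , ac′) ∷ (ad , ad′) ∷ []) ∷ ((bc , bc′) ∷ (bd , bd′) ∷ []) ∷
        ((cd , cd′) ∷ []) ∷ [] ∷ []

      -- The sum has the shape to which `codegSum` of a four-element list unfolds. In both uses the
      -- six bounds are numerals adding up to 3, so the conclusion is absurd by computation.
      spread-codegrees : ∀ {a b c d i j k l p q} → Spread G (a ∷ b ∷ c ∷ d ∷ []) →
        codeg G a b ≤ i → codeg G a c ≤ j → codeg G a d ≤ k →
        codeg G b c ≤ l → codeg G b d ≤ p → codeg G c d ≤ q →
        4 ≤ i + (j + (k + 0)) + (l + (p + 0) + (q + 0 + 0))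
      spread-codegrees sp ab ac ad bc bd cd = ≤-trans (codegSum≥4 G σ≥n sp)
        (+-mono-≤ (+-mono-≤ ab (+-mono-≤ ac (+-mono-≤ ad z≤n)))
          (+-mono-≤ (+-mono-≤ bc (+-mono-≤ bd z≤n)) (+-mono-≤ (+-mono-≤ cd z≤n) z≤n)))

      -- A common neighbour lies in `C` and has the neighbour `w` outside, so it is the end `y` of
      -- the bridge.
      codeg-interior : ∀ {C y x v w} → Side C y x → (∀ {t} → v ~ t → t ∈ C) → w ∉ C → codeg G v w ≤ 1
      codeg-interior {y = y} {v = v} {w} s nbrs w∉C =
        codeg≤1 v w y λ v~t w~t → proj₁ (Side.only s (nbrs v~t) w∉C (~-sym w~t))

      ∈∉⇒≢ : ∀ {C : Subset n} {u v} → u ∈ C → v ∉ C → u ≢ v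
      ∈∉⇒≢ u∈C v∉C refl = v∉C u∈C

      -- Interior vertices of disjoint sides have no common neighbour, and each shares with `w` at
      -- most the end of its own bridge: the six codegrees add up to at most 3.
      three-sides : ∀ {C₁ C₂ C₃ y₁ x₁ y₂ x₂ y₃ x₃ w} →
                    Side C₁ y₁ x₁ → Side C₂ y₂ x₂ → Side C₃ y₃ x₃ →
                    (∀ {t} → t ∈ C₁ → t ∉ C₂) → (∀ {t} → t ∈ C₁ → t ∉ C₃) → (∀ {t} → t ∈ C₂ → t ∉ C₃) →
                    w ∉ C₁ → w ∉ C₂ → w ∉ C₃ → ⊥
      three-sides {w = w} s₁ s₂ s₃ d₁₂ d₁₃ d₂₃ w∉₁ w∉₂ w∉₃
        with interior s₁ | interior s₂ | interior s₃
      ... | v₁ , v₁∈ , n₁ | v₂ , v₂∈ , n₂ | v₃ , v₃∈ , n₃ = <⇒≱ ≤-refl (spread-codegrees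
        (spread (∈∉⇒≢ v₁∈ (λ v₂∈₁ → d₁₂ v₂∈₁ v₂∈)) (λ e → d₁₂ (n₁ e) v₂∈)
                (∈∉⇒≢ v₁∈ (λ v₃∈₁ → d₁₃ v₃∈₁ v₃∈)) (λ e → d₁₃ (n₁ e) v₃∈)
                (∈∉⇒≢ v₁∈ w∉₁) (λ e → w∉₁ (n₁ e))
                (∈∉⇒≢ v₂∈ (λ v₃∈₂ → d₂₃ v₃∈₂ v₃∈)) (λ e → d₂₃ (n₂ e) v₃∈)
                (∈∉⇒≢ v₂∈ w∉₂) (λ e → w∉₂ (n₂ e))
                (∈∉⇒≢ v₃∈ w∉₃) (λ e → w∉₃ (n₃ e)))
        (codeg≤0 v₁ v₂ λ p q → d₁₂ (n₁ p) (n₂ q))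
        (codeg≤0 v₁ v₃ λ p q → d₁₃ (n₁ p) (n₃ q))
        (codeg-interior s₁ n₁ w∉₁)
        (codeg≤0 v₂ v₃ λ p q → d₂₃ (n₂ p) (n₃ q))
        (codeg-interior s₂ n₂ w∉₂)
        (codeg-interior s₃ n₃ w∉₃))

      -- Four successive bridges: interior vertices of the two extreme sides, one
      -- vertex p between the first two bridges and one vertex q between the last two.
      four-bridges : ∀ {L D₂ D₃ D₄ y₁ x₁ y₂ x₂ y₃ x₃ y₄ x₄ p q} →
                     Side L y₁ x₁ → Side D₂ y₂ x₂ → Side D₃ y₃ x₃ → Side D₄ y₄ x₄ →
                     (∀ {t} → t ∈ L → t ∉ D₂) → D₃ ⊆ D₂ → D₄ ⊆ D₃ →
                     y₂ ∉ D₃ → p ∉ L → p ∉ D₂ → q ∈ D₃ → q ∉ D₄ → ⊥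
      four-bridges {x₃ = x₃} {p = p} {q} s₁ s₂ s₃ s₄ L∩D₂ D₃⊆D₂ D₄⊆D₃ y₂∉D₃ p∉L p∉D₂ q∈D₃ q∉D₄
        with interior s₁ | interior s₄
      ... | u , u∈ , n₁ | v , v∈ , n₄ = <⇒≱ ≤-refl (spread-codegrees
        (spread (∈∉⇒≢ u∈ (λ v∈L → L∩D₂ v∈L (D₄⊆D₂ v∈))) (λ e → L∩D₂ (n₁ e) (D₄⊆D₂ v∈))
                (∈∉⇒≢ u∈ p∉L) (λ e → p∉L (n₁ e))
                (∈∉⇒≢ u∈ (λ q∈L → L∩D₂ q∈L q∈D₂)) (λ e → L∩D₂ (n₁ e) q∈D₂)
                (∈∉⇒≢ (D₄⊆D₂ v∈) p∉D₂) (λ e → p∉D₂ (D₄⊆D₂ (n₄ e)))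
                (∈∉⇒≢ v∈ q∉D₄) (λ e → q∉D₄ (n₄ e))
                (≢-sym (∈∉⇒≢ q∈D₂ p∉D₂)) (λ e → ¬enter-D₃ p∉D₂ q∈D₃ e))
        (codeg≤0 u v λ e d → L∩D₂ (n₁ e) (D₄⊆D₂ (n₄ d)))
        (codeg-interior s₁ n₁ p∉L)
        (codeg≤0 u q λ e d → ¬enter-D₃ (L∩D₂ (n₁ e)) q∈D₃ (~-sym d))
        (codeg≤0 v p λ e d → ¬enter-D₃ p∉D₂ (D₄⊆D₃ (n₄ e)) d)
        (codeg-interior s₄ n₄ q∉D₄)
        (codeg≤1 p q x₃ λ d e → proj₂ (Side.only s₃ q∈D₃ (λ w∈D₃ → ¬enter-D₃ p∉D₂ w∈D₃ d) e)))
        where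
        D₄⊆D₂ : ∀ {t} → t ∈ _ → t ∈ _
        D₄⊆D₂ = D₃⊆D₂ ∘ D₄⊆D₃
        q∈D₂ = D₃⊆D₂ q∈D₃
        ¬enter-D₃ : ∀ {s t} → s ∉ _ → t ∈ _ → ¬ s ~ t
        ¬enter-D₃ s∉D₂ t∈D₃ s~t =
          y₂∉D₃ (subst (_∈ _) (proj₁ (Side.only s₂ (D₃⊆D₂ t∈D₃) s∉D₂ (~-sym s~t))) t∈D₃)

      record Continuation (D : Subset n) (r : Fin n) (K : Core D r) : Set where
        open Core K
        field
          D′    : Subset n
          D′⊆D  : D′ ⊆ D
          D′∩S  : ∀ {t} → t ∈ D′ → t ∉ S
          cover : ∀ {t} → t ∈ D → t ∈ S ⊎ t ∈ D′
          y x   : Fin n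
          side  : Side D′ y x
          x∈S   : x ∈ S

      -- A second branch would be a third side around r, next to the first one and ∁ D.
      continue : ∀ {D r x₀} → Side D r x₀ → (K : Core D r) →
                 (∀ {t} → t ∈ D → t ∈ Core.S K) ⊎ Continuation D r K
      continue {D} {r} s K with any? (λ z → (z ∈? D) ×-dec ¬? (z ∈? Core.S K))
      ... | no none = inj₁ λ {z} z∈D → decidable-stable (z ∈? Core.S K) λ z∉S → none (z , z∈D , z∉S)
      ... | yes (z , z∈D , z∉S) = inj₂ go
        where
        open Core K
        B = branch z z∈D z∉S
        module B = Branch B
        C⊆D : B.C ⊆ D
        C⊆D = p─q⊆p D S ∘ B.C⊆U
        C∩S : ∀ {t} → t ∈ B.C → t ∉ S
        C∩S = ∉─ D S ∘ B.C⊆U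
        go : Continuation D r K
        go with any? (λ z → (z ∈? D) ×-dec (¬? (z ∈? S) ×-dec ¬? (z ∈? B.C)))
        ... | no none = record
          { D′ = B.C ; D′⊆D = C⊆D ; D′∩S = C∩S ; y = B.y ; x = B.x ; side = B.side ; x∈S = B.x∈S
          ; cover = λ {t} → cover t }
          where
          cover : ∀ t → t ∈ D → t ∈ S ⊎ t ∈ B.C
          cover t t∈D with t ∈? S | t ∈? B.C
          ... | yes t∈S | _       = inj₁ t∈S
          ... | no _    | yes t∈C = inj₂ t∈C
          ... | no t∉S  | no t∉C  = contradiction (t , t∈D , t∉S , t∉C) none
        ... | yes (z′ , z′∈D , z′∉S , z′∉C) = ⊥-elim (three-sides (opposite s) B.side B′.side
            (λ t∈∁D t∈C → x∈∁p⇒x∉p t∈∁D (C⊆D t∈C))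
            (λ t∈∁D t∈C′ → x∈∁p⇒x∉p t∈∁D (p─q⊆p D S (B′.C⊆U t∈C′)))
            (λ t∈C t∈C′ → z′∉C (closed-walk B.comp B′.C⊆U (flip G (B′.linked t∈C′)) t∈C))
            (x∈p⇒x∉∁p (Side.y∈C s)) (λ r∈C → C∩S r∈C r∈S) (λ r∈C′ → ∉─ D S (B′.C⊆U r∈C′) r∈S))
          where module B′ = Branch (branch z′ z′∈D z′∉S)

      -- For two or three good sets the marked bridge is the one leaving `L`, for four it is the
      -- second. Either way at most two good sets remain on each side of the mark, within reach of
      -- `bridge-semi`.
      chain-colourable : ∀ {L y x} → Side L y x → GoodSet L → CfColourable G 2
      chain-colourable {L} {y₁} {x₁} s₁ (_ , gL) = first (continue (opposite s₁) K₂)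
        where
        module s₁ = Side s₁
        K₂ = side-core (opposite s₁)
        module K₂ = Core K₂
        L∩S₂ : ∀ {t} → t ∈ L → t ∉ K₂.S
        L∩S₂ t∈L t∈S₂ = x∈∁p⇒x∉p (K₂.S⊆D t∈S₂) t∈L
        cover₁ : ∀ t → t ∈ L ⊎ t ∈ ∁ L
        cover₁ t with t ∈? L
        ... | yes t∈L = inj₁ t∈L
        ... | no  t∉L = inj₂ (x∉p⇒x∈∁p t∉L)
        first : (∀ {t} → t ∈ ∁ L → t ∈ K₂.S) ⊎ Continuation (∁ L) x₁ K₂ → CfColourable G 2
        first (inj₁ all) = bridge-colourable G L∩S₂ s₁.y∈C K₂.r∈S s₁.edge
          (λ t → [ inj₁ , inj₂ ∘ all ]′ (cover₁ t))
          (good⇒semi G gL) (good⇒semi G (proj₂ K₂.good))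
        first (inj₂ N₂) = second (continue N₂.side K₃)
          where
          module N₂ = Continuation N₂
          module s₂ = Side N₂.side
          K₃ = side-core N₂.side
          module K₃ = Core K₃
          S₂∩S₃ : ∀ {t} → t ∈ K₂.S → t ∉ K₃.S
          S₂∩S₃ t∈S₂ t∈S₃ = N₂.D′∩S (K₃.S⊆D t∈S₃) t∈S₂
          L∩D₂ : ∀ {t} → t ∈ L → t ∉ N₂.D′
          L∩D₂ t∈L t∈D = x∈∁p⇒x∉p (N₂.D′⊆D t∈D) t∈L
          cover₂ : ∀ t → t ∈ L ⊎ t ∈ K₂.S ⊎ t ∈ N₂.D′
          cover₂ t = [ inj₁ , inj₂ ∘ N₂.cover ]′ (cover₁ t)
          second : (∀ {t} → t ∈ N₂.D′ → t ∈ K₃.S) ⊎ Continuation N₂.D′ N₂.y K₃ → CfColourable G 2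
          second (inj₁ all) = bridge-colourable G
            (λ t∈L t∈ → [ L∩S₂ t∈L , L∩D₂ t∈L ∘ K₃.S⊆D ]′ (x∈p∪q⁻ K₂.S K₃.S t∈))
            s₁.y∈C (p⊆p∪q K₃.S K₂.r∈S) s₁.edge
            (λ t → [ inj₁ , inj₂ ∘ [ p⊆p∪q K₃.S , q⊆p∪q K₂.S K₃.S ∘ all ]′ ]′ (cover₂ t))
            (good⇒semi G gL)
            (bridge-semi G S₂∩S₃ N₂.x∈S K₃.r∈S (~-sym s₂.edge) (proj₂ K₂.good) (proj₂ K₃.good))
          second (inj₂ N₃) = third (continue N₃.side K₄)
            where
            module N₃ = Continuation N₃
            module s₃ = Side N₃.side
            K₄ = side-core N₃.side
            module K₄ = Core K₄
            third : (∀ {t} → t ∈ N₃.D′ → t ∈ K₄.S) ⊎ Continuation N₃.D′ N₃.y K₄ → CfColourable G 2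
            third (inj₁ all) = bridge-colourable G {S = L ∪ K₂.S} {T = K₃.S ∪ K₄.S}
              (λ t∈ t∈′ → [ (λ t∈L → L∩D₂ t∈L (S₃∪S₄⊆D₂ t∈′)) , (λ t∈S₂ → N₂.D′∩S (S₃∪S₄⊆D₂ t∈′) t∈S₂) ]′
                            (x∈p∪q⁻ L K₂.S t∈))
              (q⊆p∪q L K₂.S N₂.x∈S) (p⊆p∪q K₄.S K₃.r∈S) (~-sym s₂.edge)
              (λ t → [ inj₁ ∘ p⊆p∪q K₂.S , [ inj₁ ∘ q⊆p∪q L K₂.S ,
                       inj₂ ∘ [ p⊆p∪q K₄.S , q⊆p∪q K₃.S K₄.S ∘ all ]′ ∘ N₃.cover ]′ ]′ (cover₂ t))
              (bridge-semi G L∩S₂ s₁.y∈C K₂.r∈S s₁.edge gL (proj₂ K₂.good))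
              (bridge-semi G (λ t∈S₃ t∈S₄ → N₃.D′∩S (K₄.S⊆D t∈S₄) t∈S₃) N₃.x∈S K₄.r∈S (~-sym s₃.edge)
                (proj₂ K₃.good) (proj₂ K₄.good))
              where
              S₃∪S₄⊆D₂ : ∀ {t} → t ∈ K₃.S ∪ K₄.S → t ∈ N₂.D′
              S₃∪S₄⊆D₂ t∈ = [ K₃.S⊆D , N₃.D′⊆D ∘ K₄.S⊆D ]′ (x∈p∪q⁻ K₃.S K₄.S t∈)
            third (inj₂ N₄) = ⊥-elim (four-bridges s₁ N₂.side N₃.side N₄.side
              L∩D₂ N₃.D′⊆D N₄.D′⊆D
              (λ y₂∈D₃ → N₃.D′∩S y₂∈D₃ K₃.r∈S)
              -- The two middle vertices are the roots of the cores `K₂` and `K₄`, namely the far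
              -- ends of the first and third bridges as seen from `L`.
              s₁.x∉C (λ x₁∈D₂ → N₂.D′∩S x₁∈D₂ K₂.r∈S) s₃.y∈C (λ y₃∈D₄ → N₄.D′∩S y₃∈D₄ K₄.r∈S))
              where module N₄ = Continuation N₄

      colourable : Fin n → CfColourable G 2
      colourable r with core {D = ⊤} {r} (λ _ v∉⊤ → contradiction ∈⊤ v∉⊤) ∈⊤
      ... | K with any? (λ z → ¬? (z ∈? Core.S K))
      ... | no none = good-colourable G
              (λ z → decidable-stable (z ∈? Core.S K) λ z∉S → none (z , z∉S)) (proj₂ (Core.good K))
      ... | yes (z , z∉S) with leaf (Branch.side (Core.branch K z ∈⊤ z∉S))
      ...   | _ , _ , _ , s , good = chain-colourable s good

  -- With one colour, its number of occurrences is the length of the path, so a conflict-free path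
  -- is a single edge and all distinct vertices would be adjacent. With no colour there is none to
  -- occur exactly once.
  two-colours-needed : ¬ Complete G → ∀ k → CfColourable G k → 2 ≤ k
  two-colours-needed ¬complete zero (c , connect) =
    contradiction (λ u v u≢v → ⊥-elim (no-colour (connect u v u≢v))) ¬complete
    where
    no-colour : ∀ {u v} → ¬ (Σ[ p ∈ Star _~_ u v ] IsPath G p × ConflictFree G c p)
    no-colour (_ , _ , () , _)
  two-colours-needed ¬complete (suc zero) (c , connect) =
    contradiction (λ u v u≢v → one-edge (connect u v u≢v)) ¬complete
    where
    one-edge : ∀ {u v} → Σ[ p ∈ Star _~_ u v ] IsPath G p × ConflictFree G c p → u ~ v
    one-edge (ε , _ , zero , ())
    one-edge (e ◅ ε , _) = e
    one-edge (e ◅ d ◅ p , _ , zero , count)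
      with trans (sym (cong length (filter-all (zero ≟_)
             (All.universal (λ { zero → refl }) (colours G c (e ◅ d ◅ p)))))) count
    ... | ()
  two-colours-needed _ (suc (suc _)) _ = s≤s (s≤s z≤n)

theorem6 : ∀ (n : ℕ) → 9 ≤ n → (G : Graph n) → Connected G → ¬ Complete G →
    [ 2 ] ≤∞ δ G → [ n ] ≤∞ σ G 4 → Cfc≡ G 2
theorem6 (suc n) _ G connected ¬complete δ≥2 σ≥n =
  colourable G connected δ≥2 σ≥n zero , two-colours-needed G ¬complete
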